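{- The logics $\mathrm{LTLf}^+$, $\mathrm{PPLTL}^+$ and $\mathrm{LTL}$ define the same infinite-trace properties: a set $Z\subseteq (2^{AP})^\omega$ equals $[\Psi]$ for some $\mathrm{LTLf}^+$ formula $\Psi$ iff it equals $[\Psi']$ for some $\mathrm{PPLTL}^+$ formula $\Psi'$ iff it equals $[\varphi]$ for some $\mathrm{LTL}$ formula $\varphi$.
   Context: $AP$ is a finite nonempty set of atoms and $\Sigma=2^{AP}$. A trace is a nonempty finite or infinite sequence $\tau=\tau_0\tau_1\cdots$ over $\Sigma$; $|\tau|$ is its length. LTLf formulas: $\varphi::=p\mid\neg\varphi\mid\varphi\wedge\varphi\mid X\varphi\mid \varphi U\varphi$ ($p\in AP$), interpreted on finite traces: $\tau,i\models p$ iff $p\in\tau_i$; Boolean connectives as usual; $\tau,i\models X\varphi$ iff $i+1<|\tau|$ and $\tau,i+1\models\varphi$; $\tau,i\models\varphi_1U\varphi_2$ iff there is $k$ with $i\le k<|\tau|$, $\tau,k\models\varphi_2$ and $\tau,j\models\varphi_1$ for all $i\le j<k$. $[\varphi]$ is the set of finite traces with $\tau,0\models\varphi$. PPLTL formulas: $\varphi::=p\mid\neg\varphi\mid\varphi\wedge\varphi\mid Y\varphi\mid\varphi S\varphi$, with $\tau,i\models Y\varphi$ iff $i>0$ and $\tau,i-1\models\varphi$; $\tau,i\models\varphi_1S\varphi_2$ iff there is $k$ with $0\le k\le i$, $\tau,k\models\varphi_2$ and $\tau,j\models\varphi_1$ for all $k<j\le i$. $[\varphi]$ is the set of finite traces with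 $\tau,|\tau|-1\models\varphi$. LTL: same syntax as LTLf, interpreted on infinite traces with the same clauses but without the bound $|\tau|$; $[\varphi]$ is the set of infinite traces with $\tau,0\models\varphi$. For a set $Z$ of finite traces: $\forall Z$ (resp. $\exists Z$) is the set of infinite traces all (resp. some) of whose nonempty finite prefixes lie in $Z$; $\exists^\infty Z$ (resp. $\forall^\infty Z$) is the set of infinite traces infinitely many (resp. all but finitely many) of whose nonempty finite prefixes lie in $Z$. $\mathrm{LTLf}^+$ (resp. $\mathrm{PPLTL}^+$) formulas: $\Psi::=\forall\Phi\mid\exists\Phi\mid\exists^\infty\Phi\mid\forall^\infty\Phi\mid\Psi\vee\Psi\mid\Psi\wedge\Psi\mid\neg\Psi$ where $\Phi$ ranges over LTLf (resp. PPLTL) formulas; semantics: $[\mathbb{Q}\Phi]=\mathbb{Q}[\Phi]$ for $\mathbb{Q}\in\{\forall,\exists,\exists^\infty,\forall^\infty\}$, and Boolean connectives are union, intersection and complement in $(2^{AP})^\omega$. -}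

module Defs where

open import Data.Nat using (ℕ; zero; suc; _≤_; _<_)
open import Data.Fin using (Fin; toℕ; fromℕ)
open import Data.Fin.Subset using (Subset; _∈_)
open import Data.Product using (Σ; _×_; ∃)
open import Data.Sum using (_⊎_)
open import Relation.Nullary using (¬_)
open import Function.Bundles using (_⇔_)
open import Relation.Binary.PropositionalEquality using (_≡_)
import Data.Fin as Fin

-- AP = Fin (suc n) (a finite nonempty set of atoms); letters Σ = 2^AP.
Letter : ℕ → Set
Letter n = Subset (suc n)

InfTrace : ℕ → Set
InfTrace n = ℕ → Letter n

-- Nonempty finite traces: length is suc len-1.
record FinTrace (n : ℕ) : Set where
  constructor mkTrace
  field
    len-1 : ℕ
    at    : Fin (suc len-1) → Letter n
open FinTrace public

InfProp : ℕ → Set₁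
InfProp n = InfTrace n → Set

FinProp : ℕ → Set₁
FinProp n = FinTrace n → Set

_≐_ : ∀ {n} → InfProp n → InfProp n → Set
Z ≐ Z' = ∀ w → Z w ⇔ Z' w

-- Future-time syntax (shared by LTLf and LTL)

data FLTL (n : ℕ) : Set where
  atom : Fin (suc n) → FLTL n
  ¬ᶠ_  : FLTL n → FLTL n
  _∧ᶠ_ : FLTL n → FLTL n → FLTL n
  Xᶠ   : FLTL n → FLTL n
  _Uᶠ_ : FLTL n → FLTL n → FLTL n

data PLTL (n : ℕ) : Set where
  atom : Fin (suc n) → PLTL n
  ¬ᵖ_  : PLTL n → PLTL n
  _∧ᵖ_ : PLTL n → PLTL n → PLTL n
  Yᵖ   : PLTL n → PLTL n
  _Sᵖ_ : PLTL n → PLTL n → PLTL n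

satF : ∀ {n} (τ : FinTrace n) → Fin (suc (len-1 τ)) → FLTL n → Set
satF τ i (atom p)  = p ∈ at τ i
satF τ i (¬ᶠ φ)    = ¬ satF τ i φ
satF τ i (φ ∧ᶠ ψ)  = satF τ i φ × satF τ i ψ
satF τ i (Xᶠ φ)    = Σ (Fin (suc (len-1 τ))) λ j → (toℕ j ≡ suc (toℕ i)) × satF τ j φ
satF τ i (φ Uᶠ ψ)  = Σ (Fin (suc (len-1 τ))) λ k →
  (toℕ i ≤ toℕ k) × satF τ k ψ ×
  (∀ (j : Fin (suc (len-1 τ))) → toℕ i ≤ toℕ j → toℕ j < toℕ k → satF τ j φ)

⟦_⟧ᶠ : ∀ {n} → FLTL n → FinProp n
⟦ φ ⟧ᶠ τ = satF τ Fin.zero φ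

satP : ∀ {n} (τ : FinTrace n) → Fin (suc (len-1 τ)) → PLTL n → Set
satP τ i (atom p)  = p ∈ at τ i
satP τ i (¬ᵖ φ)    = ¬ satP τ i φ
satP τ i (φ ∧ᵖ ψ)  = satP τ i φ × satP τ i ψ
satP τ i (Yᵖ φ)    = Σ (Fin (suc (len-1 τ))) λ j → (suc (toℕ j) ≡ toℕ i) × satP τ j φ
satP τ i (φ Sᵖ ψ)  = Σ (Fin (suc (len-1 τ))) λ k →
  (toℕ k ≤ toℕ i) × satP τ k ψ ×
  (∀ (j : Fin (suc (len-1 τ))) → toℕ k < toℕ j → toℕ j ≤ toℕ i → satP τ j φ)

⟦_⟧ᵖ : ∀ {n} → PLTL n → FinProp n
⟦ φ ⟧ᵖ τ = satP τ (fromℕ (len-1 τ)) φ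

satL : ∀ {n} (w : InfTrace n) → ℕ → FLTL n → Set
satL w i (atom p)  = p ∈ w i
satL w i (¬ᶠ φ)    = ¬ satL w i φ
satL w i (φ ∧ᶠ ψ)  = satL w i φ × satL w i ψ
satL w i (Xᶠ φ)    = satL w (suc i) φ
satL w i (φ Uᶠ ψ)  = Σ ℕ λ k → (i ≤ k) × satL w k ψ × (∀ j → i ≤ j → j < k → satL w j φ)

⟦_⟧ˡ : ∀ {n} → FLTL n → InfProp n
⟦ φ ⟧ˡ w = satL w 0 φ

-- the nonempty prefix of w of length suc m
prefix : ∀ {n} → InfTrace n → ℕ → FinTrace n
prefix w m = mkTrace m (λ i → w (toℕ i))

Qall Qex Qinf Qev : ∀ {n} → FinProp n → InfProp n
Qall Z w = ∀ m → Z (prefix w m)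
Qex  Z w = ∃ λ m → Z (prefix w m)
Qinf Z w = ∀ k → ∃ λ m → k ≤ m × Z (prefix w m)
Qev  Z w = ∃ λ k → ∀ m → k ≤ m → Z (prefix w m)

data Plus (F : Set) : Set where
  ∀ᴾ ∃ᴾ ∃∞ᴾ ∀∞ᴾ : F → Plus F
  _∨ᴾ_ _∧ᴾ_ : Plus F → Plus F → Plus F
  ¬ᴾ_ : Plus F → Plus F

⟦_⟧⁺ : ∀ {n} {F : Set} → (F → FinProp n) → Plus F → InfProp n
⟦ sem ⟧⁺ (∀ᴾ φ) = Qall (sem φ)
⟦ sem ⟧⁺ (∃ᴾ φ) = Qex (sem φ)
⟦ sem ⟧⁺ (∃∞ᴾ φ) = Qinf (sem φ)
⟦ sem ⟧⁺ (∀∞ᴾ φ) = Qev (sem φ)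
⟦ sem ⟧⁺ (Ψ ∨ᴾ Ψ') w = ⟦ sem ⟧⁺ Ψ w ⊎ ⟦ sem ⟧⁺ Ψ' w
⟦ sem ⟧⁺ (Ψ ∧ᴾ Ψ') w = ⟦ sem ⟧⁺ Ψ w × ⟦ sem ⟧⁺ Ψ' w
⟦ sem ⟧⁺ (¬ᴾ Ψ) w = ¬ ⟦ sem ⟧⁺ Ψ w

LTLf⁺ PPLTL⁺ : ℕ → Set
LTLf⁺ n = Plus (FLTL n)
PPLTL⁺ n = Plus (PLTL n)

⟦_⟧LTLf⁺ : ∀ {n} → LTLf⁺ n → InfProp n
⟦_⟧LTLf⁺ = ⟦ ⟦_⟧ᶠ ⟧⁺

⟦_⟧PPLTL⁺ : ∀ {n} → PPLTL⁺ n → InfProp n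
⟦_⟧PPLTL⁺ = ⟦ ⟦_⟧ᵖ ⟧⁺

{-# OPTIONS --safe #-}
module Submission where

-- Every temporal operator is a flip-flop: the value of φ U ψ at a position is set by ψ, reset
-- by ¬φ ∧ ¬ψ and otherwise copied from the neighbouring position, and dually for φ S ψ.
-- Hence it suffices to eliminate, from a property speaking about an extra atom p, one
-- flip-flop at a time when p runs against the reading direction. Future formulas absorb a
-- flip-flop driven from the past by a case split on its current value; the past logic on a
-- finite trace is the mirror image. For infinite traces, Boolean combinations of "φ holds at
-- infinitely many positions" with φ past absorb a flip-flop driven from the future. Finally,
-- every quantifier of PPLTL⁺ is an LTL formula in p, and "p holds at the first position" is a
-- recurrence property because "p holds at the first position of the prefix" is a past formula.

open import Defs
open import Level using (0ℓ; Lift; lift)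
open import Data.Bool using (Bool; true; false)
open import Data.Empty using (⊥-elim)
open import Data.Fin using (Fin; zero; suc; toℕ; fromℕ; fromℕ<)
open import Data.Fin.Properties using (toℕ-fromℕ; toℕ-fromℕ<; toℕ≤pred[n])
open import Data.Fin.Subset using (_∈_)
open import Data.Nat using (ℕ; zero; suc; _+_; _∸_; _≤_; _<_; z≤n; s≤s; s≤s⁻¹; _⊔_)
open import Data.Nat.Properties
  using (≤-refl; ≤-trans; <⇒≤; <⇒≱; n≤1+n; m≤n⇒m≤1+n; m≤n⇒m<n∨m≡n; m≤m+n; m≤n+m; m∸n+n≡m;
         +-suc; m≤m⊔n; m≤n⊔m)
open import Data.Product using (Σ; ∃; _×_; _,_; proj₁; proj₂; map₂)
open import Data.Product.Function.NonDependent.Propositional using (_×-⇔_)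
open import Data.Sum using (_⊎_; inj₁; inj₂; [_,_])
open import Data.Sum.Function.Propositional using (_⊎-⇔_)
open import Data.Unit using (⊤; tt)
open import Function using (_∘_; _∘′_; id; flip; case_of_)
open import Function.Bundles using (_⇔_; mk⇔; Equivalence)
open import Function.Properties.Equivalence using ()
  renaming (refl to ⇔-refl; sym to ⇔-sym; trans to ⇔-trans)
open import Function.Related.TypeIsomorphisms using (¬-cong-⇔)
open import Relation.Binary.PropositionalEquality using (_≡_; refl; sym; cong; cong₂; subst)
open import Relation.Nullary using (¬_; yes; no)
open import Axiom.ExcludedMiddle using (ExcludedMiddle)

open Equivalence using (to; from)

-- Temporal logic over an arbitrary successor relation

Rel : Set₁
Rel = ℕ → ℕ → Set

Val : ℕ → Set₁
Val n = ℕ → Fin (suc n) → Set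

-- Inductive along `R` instead of bounded by an index, so that one definition covers both reading
-- directions, finite and infinite traces, and proofs can recurse on the derivation.
data Until (R : Rel) (P Q : ℕ → Set) : ℕ → Set where
  now   : ∀ {i} → Q i → Until R P Q i
  later : ∀ {i j} → P i → R i j → Until R P Q j → Until R P Q i

-- FLTL serves as syntax for both logics: past formulas are read along the converse relation.
sat : ∀ {n} → Rel → Val n → ℕ → FLTL n → Set
sat R V i (atom p) = V i p
sat R V i (¬ᶠ φ)   = ¬ sat R V i φ
sat R V i (φ ∧ᶠ ψ) = sat R V i φ × sat R V i ψ
sat R V i (Xᶠ φ)   = ∃ λ j → R i j × sat R V j φ
sat R V i (φ Uᶠ ψ) = Until R (λ j → sat R V j φ) (λ j → sat R V j ψ) i

Next : Rel → (ℕ → Set) → ℕ → Set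
Next R P i = ∃ λ j → R i j × P j

Until-map : ∀ {R P Q P′ Q′} → (∀ {i} → P i → P′ i) → (∀ {i} → Q i → Q′ i) →
            ∀ {i} → Until R P Q i → Until R P′ Q′ i
Until-map f g (now q)       = now (g q)
Until-map f g (later p r u) = later (f p) r (Until-map f g u)

Until-cong : ∀ {R P Q P′ Q′} → (∀ i → P i ⇔ P′ i) → (∀ i → Q i ⇔ Q′ i) →
             ∀ i → Until R P Q i ⇔ Until R P′ Q′ i
Until-cong f g i = mk⇔ (Until-map (to (f _)) (to (g _))) (Until-map (from (f _)) (from (g _)))

Next-cong : ∀ {R P P′} → (∀ i → P i ⇔ P′ i) → ∀ i → Next R P i ⇔ Next R P′ i
Next-cong f i = mk⇔ (map₂ (map₂ (to (f _)))) (map₂ (map₂ (from (f _))))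

_≈_ : ∀ {n} → Val n → Val n → Set
V ≈ W = ∀ i p → V i p ⇔ W i p

sat-cong : ∀ {n} {R} {V W : Val n} → V ≈ W → ∀ φ i → sat R V i φ ⇔ sat R W i φ
sat-cong V≈W (atom p) i = V≈W i p
sat-cong V≈W (¬ᶠ φ)   i = ¬-cong-⇔ (sat-cong V≈W φ i)
sat-cong V≈W (φ ∧ᶠ ψ) i = sat-cong V≈W φ i ×-⇔ sat-cong V≈W ψ i
sat-cong {R = R} V≈W (Xᶠ φ)   i = Next-cong {R} (sat-cong V≈W φ) i
sat-cong V≈W (φ Uᶠ ψ) i = Until-cong (sat-cong V≈W φ) (sat-cong V≈W ψ) i

-- Substitution for atoms and valuations with a fresh atom

Sub : ℕ → ℕ → Set
Sub m n = Fin (suc m) → FLTL n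

substᶠ : ∀ {m n} → Sub m n → FLTL m → FLTL n
substᶠ σ (atom p) = σ p
substᶠ σ (¬ᶠ φ)   = ¬ᶠ (substᶠ σ φ)
substᶠ σ (φ ∧ᶠ ψ) = (substᶠ σ φ) ∧ᶠ (substᶠ σ ψ)
substᶠ σ (Xᶠ φ)   = Xᶠ (substᶠ σ φ)
substᶠ σ (φ Uᶠ ψ) = (substᶠ σ φ) Uᶠ (substᶠ σ ψ)

sat-subst : ∀ {m n} {R} {V : Val n} (σ : Sub m n) → ∀ φ i →
            sat R V i (substᶠ σ φ) ⇔ sat R (λ j p → sat R V j (σ p)) i φ
sat-subst σ (atom p) i = ⇔-refl
sat-subst σ (¬ᶠ φ)   i = ¬-cong-⇔ (sat-subst σ φ i)
sat-subst σ (φ ∧ᶠ ψ) i = sat-subst σ φ i ×-⇔ sat-subst σ ψ i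
sat-subst {R = R} σ (Xᶠ φ)   i = Next-cong {R} (sat-subst σ φ) i
sat-subst σ (φ Uᶠ ψ) i = Until-cong (sat-subst σ φ) (sat-subst σ ψ) i

infixl 5 _▸_

_▸_ : ∀ {n} → Val n → (ℕ → Set) → Val (suc n)
(V ▸ s) i zero    = s i
(V ▸ s) i (suc p) = V i p

extend : ∀ {m n} → FLTL n → Sub m n → Sub (suc m) n
extend φ σ zero    = φ
extend φ σ (suc p) = σ p

▸-cong : ∀ {n} {V W : Val n} {s t : ℕ → Set} → V ≈ W → (∀ i → s i ⇔ t i) → (V ▸ s) ≈ (W ▸ t)
▸-cong V≈W s⇔t i zero    = s⇔t i
▸-cong V≈W s⇔t i (suc p) = V≈W i p

infixr 5 _∨ᶠ_

_∨ᶠ_ : ∀ {n} → FLTL n → FLTL n → FLTL n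
φ ∨ᶠ ψ = ¬ᶠ ((¬ᶠ φ) ∧ᶠ (¬ᶠ ψ))

⊥ᶠ ⊤ᶠ : ∀ {n} → FLTL n
⊥ᶠ = atom zero ∧ᶠ (¬ᶠ atom zero)
⊤ᶠ = ¬ᶠ ⊥ᶠ

constᶠ : ∀ {n} → Bool → FLTL n
constᶠ true  = ⊤ᶠ
constᶠ false = ⊥ᶠ

Functional : Rel → Set
Functional R = ∀ {i j k} → R i j → R i k → j ≡ k

Is : Bool → Set → Set
Is true  P = P
Is false P = ¬ P

-- Flip-flops

-- A flip-flop s is driven by the atoms a and b: b sets it, ¬a ∧ ¬b resets it and a ∧ ¬b
-- keeps it. The formula assume c φ evaluates φ knowing that s currently has value c. A letter
-- that switches determines the next value of s by itself, so an until is cut at the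
-- switching letters, and a chain of such pieces is again an until.

module _ {n} (a b : Fin (suc n)) where

  hold switch reset : FLTL n
  hold   = atom a ∧ᶠ (¬ᶠ atom b)
  switch = ¬ᶠ hold
  reset  = switch ∧ᶠ (¬ᶠ atom b)

  jump : (Bool → FLTL n) → FLTL n
  jump F = (atom b ∧ᶠ Xᶠ (F true)) ∨ᶠ (reset ∧ᶠ Xᶠ (F false))

  after : Bool → FLTL n
  after c = atom b ∨ᶠ (atom a ∧ᶠ constᶠ c)

  reach : (A : Bool → FLTL n) (B : Bool → FLTL n) → Bool → FLTL n
  reach A B c = (hold ∧ᶠ A c) Uᶠ B c

  assumeU : (A B : Bool → FLTL n) → Bool → FLTL n
  assumeU A B c = reach A B c ∨ᶠ (block c ∧ᶠ ((hold ∨ᶠ jump block) Uᶠ jump (reach A B)))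
    where
    block : Bool → FLTL n
    block = reach A (λ c → switch ∧ᶠ A c)

  assume : Bool → FLTL (suc n) → FLTL n
  assume c (atom zero)    = constᶠ c
  assume c (atom (suc p)) = atom p
  assume c (¬ᶠ φ)         = ¬ᶠ (assume c φ)
  assume c (φ ∧ᶠ ψ)       = (assume c φ) ∧ᶠ (assume c ψ)
  assume c (Xᶠ φ)         = (after c ∧ᶠ Xᶠ (assume true φ)) ∨ᶠ ((¬ᶠ after c) ∧ᶠ Xᶠ (assume false φ))
  assume c (φ Uᶠ ψ)       = assumeU (λ c → assume c φ) (λ c → assume c ψ) c

-- Classical connectives

module Classical (em : ExcludedMiddle 0ℓ) where

  ¬¬-elim : {P : Set} → ¬ ¬ P → P
  ¬¬-elim {P} ¬¬p with em {P}
  ... | yes p = p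
  ... | no ¬p = ⊥-elim (¬¬p ¬p)

  de-Morgan : {P Q : Set} → (¬ (¬ P × ¬ Q)) ⇔ (P ⊎ Q)
  de-Morgan {P} {Q} = mk⇔ fwd λ { (inj₁ p) (¬p , _) → ¬p p ; (inj₂ q) (_ , ¬q) → ¬q q }
    where
    fwd : ¬ (¬ P × ¬ Q) → P ⊎ Q
    fwd h with em {P} | em {Q}
    ... | yes p | _     = inj₁ p
    ... | no _  | yes q = inj₂ q
    ... | no ¬p | no ¬q = ⊥-elim (h (¬p , ¬q))

  is? : (P : Set) → ∃ λ c → Is c P
  is? P with em {P}
  ... | yes p = true , p
  ... | no ¬p = false , ¬p

  Is-cong : ∀ c {P Q : Set} → P ⇔ Q → Is c P → Is c Q
  Is-cong true  e p  = to e p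
  Is-cong false e ¬p = ¬p ∘ from e

  Is-const : ∀ {n} {R} {V : Val n} {i} c {P : Set} → Is c P → sat R V i (constᶠ c) ⇔ P
  Is-const true  p  = mk⇔ (λ _ → p) (λ _ (x , ¬x) → ¬x x)
  Is-const false ¬p = mk⇔ (λ (x , ¬x) → ⊥-elim (¬x x)) (λ p → ⊥-elim (¬p p))

  -- Correctness of absorbing a flip-flop

  module Assume {n} (a b : Fin (suc n)) {R : Rel} (R-fun : Functional R) (V : Val n) (s : ℕ → Set)
    (update : ∀ {i j} → R i j → s j ⇔ (V i b ⊎ (V i a × s i))) where

    infix 4 _⊨_
    _⊨_ : ℕ → FLTL n → Set
    i ⊨ φ = sat R V i φ

    hold-keeps : ∀ {i j} → R i j → i ⊨ hold a b → s i ⇔ s j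
    hold-keeps r (p , ¬q) = mk⇔
      (λ si → from (update r) (inj₂ (p , si)))
      (λ sj → [ (λ q → ⊥-elim (¬q q)) , proj₂ ] (to (update r) sj))

    reset-clears : ∀ {i j} → R i j → i ⊨ reset a b → ¬ s j
    reset-clears r (sw , ¬q) sj with to (update r) sj
    ... | inj₁ q       = ¬q q
    ... | inj₂ (p , _) = sw (p , ¬q)

    -- At a switching letter the next value of `s` depends on `b` alone, so `c` decides which
    -- disjunct of the jump applies.
    jump-intro : ∀ {i j} c F → R i j → i ⊨ switch a b → Is c (s j) → j ⊨ F c → i ⊨ jump a b F
    jump-intro {i} true F r sw sj x = from de-Morgan (inj₁ (set , _ , r , x))
      where
      set : V i b
      set = ¬¬-elim λ ¬q → [ ¬q , (λ (p , _) → sw (p , ¬q)) ] (to (update r) sj)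
    jump-intro false F r sw ¬sj x =
      from de-Morgan (inj₂ ((sw , λ q → ¬sj (from (update r) (inj₁ q))) , _ , r , x))

    jump-elim : ∀ {i} F → i ⊨ jump a b F →
                ∃ λ j → ∃ λ c → R i j × (i ⊨ switch a b) × Is c (s j) × (j ⊨ F c)
    jump-elim F x with to de-Morgan x
    ... | inj₁ (q , j , r , y)          = j , true , r , (λ (_ , ¬q) → ¬q q) , from (update r) (inj₁ q) , y
    ... | inj₂ ((sw , ¬q) , j , r , y) = j , false , r , sw , reset-clears r (sw , ¬q) , y

    after-next : ∀ {i j c} → R i j → Is c (s i) → (i ⊨ after a b c) ⇔ s j
    after-next {c = c} r si = ⇔-trans de-Morgan (⇔-trans (⇔-refl ⊎-⇔ (⇔-refl ×-⇔ Is-const c si)) (⇔-sym (update r)))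

    module _ (A B : Bool → FLTL n) (P Q : ℕ → Set)
      (A⇔P : ∀ {i} c → Is c (s i) → (i ⊨ A c) ⇔ P i)
      (B⇔Q : ∀ {i} c → Is c (s i) → (i ⊨ B c) ⇔ Q i) where

      private
        block = reach a b A (λ c → switch a b ∧ᶠ A c)
        chain = (hold a b ∨ᶠ jump a b block) Uᶠ jump a b (reach a b A B)

      reach⇒U : ∀ {i} c → Is c (s i) → i ⊨ reach a b A B c → Until R P Q i
      reach⇒U c si (now q)             = now (to (B⇔Q c si) q)
      reach⇒U c si (later (h , p) r u) =
        later (to (A⇔P c si) p) r (reach⇒U c (Is-cong c (hold-keeps r h) si) u)

      -- The current block is an invariant: it certifies `P` up to and including the next switching
      -- letter, where the chain supplies the next block or the final piece. `R-fun` keeps block and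
      -- chain at the same position.
      chain⇒U : ∀ {i} c → Is c (s i) → i ⊨ block c → i ⊨ chain → Until R P Q i
      chain⇒U c si blk (now l) with jump-elim (reach a b A B) l | blk
      ... | j , c′ , r , sw , sj , x | now (_ , p)         = later (to (A⇔P c si) p) r (reach⇒U c′ sj x)
      ... | j , c′ , r , sw , sj , x | later (h , _) _ _   = ⊥-elim (sw h)
      chain⇒U c si blk (later g r ch) with to de-Morgan g
      ... | inj₁ h with blk
      ...   | now (sw , _)        = ⊥-elim (sw h)
      ...   | later (_ , p) r′ blk′ with R-fun r r′
      ...     | refl = later (to (A⇔P c si) p) r (chain⇒U c (Is-cong c (hold-keeps r h) si) blk′ ch)
      chain⇒U c si blk (later g r ch) | inj₂ g′ with jump-elim block g′ | blk
      ... | j , c′ , r′ , sw , sj , x | later (h , _) _ _ = ⊥-elim (sw h)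
      ... | j , c′ , r′ , sw , sj , x | now (_ , p) with R-fun r r′
      ...   | refl = later (to (A⇔P c si) p) r (chain⇒U c′ sj x ch)

      -- The decomposition of the tail is extended by one position: a holding letter prolongs the
      -- first piece, while a switching letter forms a block by itself and the first piece of the
      -- tail becomes the target of a jump.
      U⇒assumeU : ∀ {i} c → Is c (s i) → Until R P Q i → i ⊨ assumeU a b A B c
      U⇒assumeU c si (now q) = from de-Morgan (inj₁ (now (from (B⇔Q c si) q)))
      U⇒assumeU {i} c si (later {j = j} p r u) with em {i ⊨ hold a b}
      ... | yes h with to de-Morgan (U⇒assumeU c (Is-cong c (hold-keeps r h) si) u)
      ...   | inj₁ l          = from de-Morgan (inj₁ (later (h , from (A⇔P c si) p) r l))
      ...   | inj₂ (blk , ch) = from de-Morgan (inj₂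
          (later (h , from (A⇔P c si) p) r blk , later (from de-Morgan (inj₁ h)) r ch))
      U⇒assumeU {i} c si (later {j = j} p r u) | no sw with is? (s j)
      ... | c′ , sj with to de-Morgan (U⇒assumeU c′ sj u)
      ...   | inj₁ l          = from de-Morgan (inj₂
          (now (sw , from (A⇔P c si) p) , now (jump-intro c′ (reach a b A B) r sw sj l)))
      ...   | inj₂ (blk , ch) = from de-Morgan (inj₂
          (now (sw , from (A⇔P c si) p) , later (from de-Morgan (inj₂ (jump-intro c′ block r sw sj blk))) r ch))

      assumeU-correct : ∀ {i} c → Is c (s i) → (i ⊨ assumeU a b A B c) ⇔ Until R P Q i
      assumeU-correct c si = mk⇔ ([ reach⇒U c si , (λ (blk , ch) → chain⇒U c si blk ch) ] ∘ to de-Morgan) (U⇒assumeU c si)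

    assume-correct : ∀ φ {i} c → Is c (s i) → (i ⊨ assume a b c φ) ⇔ sat R (V ▸ s) i φ
    assume-correct (atom zero)    c si = Is-const c si
    assume-correct (atom (suc p)) c si = ⇔-refl
    assume-correct (¬ᶠ φ)   c si = ¬-cong-⇔ (assume-correct φ c si)
    assume-correct (φ ∧ᶠ ψ) c si = assume-correct φ c si ×-⇔ assume-correct ψ c si
    assume-correct (Xᶠ φ) {i} c si = mk⇔
      (λ x → case to de-Morgan x of λ
        { (inj₁ (y , j , r , z)) → j , r , to (assume-correct φ true (to (after-next r si) y)) z
        ; (inj₂ (y , j , r , z)) → j , r , to (assume-correct φ false (y ∘ from (after-next r si))) z })
      back
      where
      back : Next R (λ j → sat R (V ▸ s) j φ) i → i ⊨ assume a b c (Xᶠ φ)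
      back (j , r , z) with em {s j}
      ... | yes sj = from de-Morgan (inj₁ (from (after-next r si) sj , j , r , from (assume-correct φ true sj) z))
      ... | no ¬sj = from de-Morgan (inj₂ (¬sj ∘ to (after-next r si) , j , r , from (assume-correct φ false ¬sj) z))
    assume-correct (φ Uᶠ ψ) c si =
      assumeU-correct (λ c → assume a b c φ) (λ c → assume a b c ψ) _ _ (assume-correct φ) (assume-correct ψ) c si

  -- The strict until is a flip-flop running against `R`: letter and value at the successor `i`
  -- determine the value at `j`. The reflexive until would also depend on the letter at `j`, hence
  -- the extra `Next`.
  Next-Until-update : ∀ {R P Q} → Functional R → ∀ {i j} → R j i →
                      Next R (Until R P Q) j ⇔ (Q i ⊎ (P i × Next R (Until R P Q) i))
  Next-Until-update {R} {P} {Q} R-fun {i} {j} r = mk⇔ fwd bwd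
    where
    fwd : Next R (Until R P Q) j → Q i ⊎ (P i × Next R (Until R P Q) i)
    fwd (_ , r′ , u) with R-fun r r′ | u
    ... | refl | now q         = inj₁ q
    ... | refl | later p r″ u′ = inj₂ (p , _ , r″ , u′)

    bwd : Q i ⊎ (P i × Next R (Until R P Q) i) → Next R (Until R P Q) j
    bwd (inj₁ q)                = i , r , now q
    bwd (inj₂ (p , _ , r′ , u)) = i , r , later p r′ u

  -- Classes of properties from which atoms denoting formulas read against the direction of R
  -- can be eliminated.
  record Class : Set₂ where
    field
      Form  : ℕ → Set
      Frame : Set₁
      R     : Frame → Rel
      Sem   : ∀ {n} → Frame → Form n → Val n → Set
      Sem-cong : ∀ {n} F (c : Form n) {V W} → V ≈ W → Sem F c V ⇔ Sem F c W
      substᶜ   : ∀ {m n} → Sub m n → Form m → Form n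
      Sem-subst : ∀ {m n} F (σ : Sub m n) c {V} →
                  Sem F (substᶜ σ c) V ⇔ Sem F c (λ i p → sat (R F) V i (σ p))
      unflip   : ∀ {n} (a b : Fin (suc n)) → Form (suc n) → Form n
      Sem-unflip : ∀ {n} F (a b : Fin (suc n)) c V →
                   let R⁻¹ = flip (R F) in
                   Sem F (unflip a b c) V ⇔
                   Sem F c (V ▸ Next R⁻¹ (Until R⁻¹ (λ i → V i a) (λ i → V i b)))

  -- Elimination by recursion on the formula

  module Elimination (K : Class) where
    open Class K

    value : ∀ {k n} → Frame → FLTL k → (Fin (suc k) → Fin (suc n)) → Val n → ℕ → Set
    value F φ ρ V i = sat (flip (R F)) (λ j p → V j (ρ p)) i φ

    -- A single `c′` must serve all frames and valuations; this uniformity later yields one formula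
    -- for prefixes of every length.
    Eliminable : ∀ {k n} → FLTL k → (Fin (suc k) → Fin (suc n)) → Form (suc n) → Set₁
    Eliminable {n = n} φ ρ c = Σ (Form n) λ c′ → ∀ F V → Sem F c′ V ⇔ Sem F c (V ▸ value F φ ρ V)

    assign : ∀ {m n} → FLTL n → (Fin (suc m) → Fin (suc n)) → Form (suc m) → Form n
    assign χ π = substᶜ (extend χ (λ q → atom (π q)))

    Sem-assign : ∀ {m n} F (χ : FLTL n) (π : Fin (suc m) → Fin (suc n)) c {W v} →
                 (∀ i → sat (R F) W i χ ⇔ v i) →
                 Sem F (assign χ π c) W ⇔ Sem F c ((λ i q → W i (π q)) ▸ v)
    Sem-assign F χ π c e = ⇔-trans (Sem-subst F _ c)
      (Sem-cong F c λ { i zero → e i ; i (suc q) → ⇔-refl })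

    Until-⊥ : ∀ {R} (P Q : ℕ → Set) {i} → Until R (λ i → P i × ¬ P i) Q i ⇔ Q i
    Until-⊥ P Q = mk⇔ (λ { (now q) → q ; (later (p , ¬p) _ _) → ⊥-elim (¬p p) }) now

    Until-unfold : ∀ {R P Q i} → (Q i ⊎ (P i × Next R (Until R P Q) i)) ⇔ Until R P Q i
    Until-unfold = mk⇔ (λ { (inj₁ q) → now q ; (inj₂ (p , _ , r , u)) → later p r u })
                       (λ { (now q) → inj₁ q ; (later p r u) → inj₂ (p , _ , r , u) })

    -- The outermost operator goes first: the atom for a formula is traded for atoms of its
    -- immediate subformulas, which are then eliminated in turn. Meanwhile `ρ` tracks where the
    -- atoms of `φ` sit among the added ones.
    eliminate : ∀ {k n} (φ : FLTL k) (ρ : Fin (suc k) → Fin (suc n)) c → Eliminable φ ρ c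
    eliminate (atom p) ρ c = assign (atom (ρ p)) id c ,
      λ F V → Sem-assign F (atom (ρ p)) id c λ _ → ⇔-refl
    eliminate (¬ᶠ φ) ρ c with eliminate φ ρ (assign (¬ᶠ atom zero) suc c)
    ... | c₁ , e₁ = c₁ , λ F V →
      ⇔-trans (e₁ F V) (Sem-assign F (¬ᶠ atom zero) suc c λ _ → ⇔-refl)
    eliminate {n = n} (φ ∧ᶠ ψ) ρ c with eliminate ψ (suc ∘ ρ) (assign both (suc ∘′ suc) c)
      where
      both : FLTL (suc (suc n))
      both = atom (suc zero) ∧ᶠ atom zero
    ... | c₂ , e₂ with eliminate φ ρ c₂
    ...   | c₁ , e₁ = c₁ , λ F V →
      ⇔-trans (e₁ F V) (⇔-trans (e₂ F _) (Sem-assign F _ (suc ∘′ suc) c λ _ → ⇔-refl))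
    -- Next is the strict until with a false left argument, so the driver `a` is an atom to which
    -- `⊥ᶠ` is assigned.
    eliminate (Xᶠ φ) ρ c
      with eliminate φ ρ (assign ⊥ᶠ id (unflip zero (suc zero) (assign (atom zero) (suc ∘′ suc ∘′ suc) c)))
    ... | c₁ , e₁ = c₁ , λ F V →
      ⇔-trans (e₁ F V)
      (⇔-trans (Sem-assign F ⊥ᶠ id (unflip zero (suc zero) _) λ _ → ⇔-refl)
      (⇔-trans (Sem-unflip F zero (suc zero) _ _)
      (Sem-assign F (atom zero) (suc ∘′ suc ∘′ suc) c (Next-cong {flip (R F)} λ _ → Until-⊥ _ _))))
    -- The until unfolds to `ψ`, or `φ` together with the strict until, which is the flip-flop
    -- driven by the atoms of `φ` and `ψ`.
    eliminate {n = n} (φ Uᶠ ψ) ρ c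
      with eliminate ψ (suc ∘ ρ) (unflip (suc zero) zero (assign unfolded (suc ∘′ suc ∘′ suc) c))
      where
      unfolded : FLTL (suc (suc (suc n)))
      unfolded = atom (suc zero) ∨ᶠ (atom (suc (suc zero)) ∧ᶠ atom zero)
    ... | c₂ , e₂ with eliminate φ ρ c₂
    ...   | c₁ , e₁ = c₁ , λ F V →
      ⇔-trans (e₁ F V)
      (⇔-trans (e₂ F _)
      (⇔-trans (Sem-unflip F (suc zero) zero _ _)
      (Sem-assign F _ (suc ∘′ suc ∘′ suc) c λ _ → ⇔-trans de-Morgan Until-unfold)))

  -- Formulas evaluated at the origin of a path

  record Path : Set₁ where
    field
      R          : Rel
      origin     : ℕ
      functional : Functional R
      injective  : Functional (flip R)
      no-pred    : ∀ {i} → ¬ R i origin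

  fromOrigin : Class
  fromOrigin = record
    { Form = FLTL
    ; Frame = Path
    ; R = Path.R
    ; Sem = λ F φ V → sat (Path.R F) V (Path.origin F) φ
    ; Sem-cong = λ F φ V≈W → sat-cong V≈W φ _
    ; substᶜ = substᶠ
    ; Sem-subst = λ F σ φ → sat-subst σ φ _
    -- Nothing precedes the origin, so a strict until read backwards is false there and the
    -- flip-flop starts with value `false`.
    ; unflip = λ a b → assume a b false
    ; Sem-unflip = λ F a b φ V → Assume.assume-correct a b (Path.functional F) V _
        (λ r → Next-Until-update (Path.injective F) r) φ false (λ (_ , r , _) → Path.no-pred F r)
    }

  -- `D` selects the positions of the trace: `(_≤ m)` for a prefix, everything for an infinite
  -- trace.
  Succ : (ℕ → Set) → Rel
  Succ D i j = j ≡ suc i × D j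

  Fut Past : Rel
  Fut  = Succ (λ _ → ⊤)
  Past = flip Fut

  Succ-functional : ∀ {D} → Functional (Succ D)
  Succ-functional (refl , _) (refl , _) = refl

  Succ-injective : ∀ {D} → Functional (flip (Succ D))
  Succ-injective (refl , _) (refl , _) = refl

  -- Recurrence properties

  Often : (ℕ → Set) → Set
  Often P = ∀ k → ∃ λ m → k ≤ m × P m

  Often-map : ∀ {P Q} → (∀ {i} → P i → Q i) → Often P → Often Q
  Often-map f h k = map₂ (map₂ f) (h k)

  Often-cong : ∀ {P Q} → (∀ i → P i ⇔ Q i) → Often P ⇔ Often Q
  Often-cong f = mk⇔ (Often-map (to (f _))) (Often-map (from (f _)))

  data Recurrence (n : ℕ) : Set where
    often : FLTL n → Recurrence n
    ¬ʳ_   : Recurrence n → Recurrence n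
    _∨ʳ_  : Recurrence n → Recurrence n → Recurrence n

  satʳ : ∀ {n} → Recurrence n → Val n → Set
  satʳ (often φ) V = Often λ i → sat Past V i φ
  satʳ (¬ʳ Φ)    V = ¬ satʳ Φ V
  satʳ (Φ ∨ʳ Ψ)  V = satʳ Φ V ⊎ satʳ Ψ V

  satʳ-cong : ∀ {n} (Φ : Recurrence n) {V W} → V ≈ W → satʳ Φ V ⇔ satʳ Φ W
  satʳ-cong (often φ) V≈W = Often-cong (sat-cong V≈W φ)
  satʳ-cong (¬ʳ Φ)    V≈W = ¬-cong-⇔ (satʳ-cong Φ V≈W)
  satʳ-cong (Φ ∨ʳ Ψ)  V≈W = satʳ-cong Φ V≈W ⊎-⇔ satʳ-cong Ψ V≈W

  substʳ : ∀ {m n} → Sub m n → Recurrence m → Recurrence n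
  substʳ σ (often φ) = often (substᶠ σ φ)
  substʳ σ (¬ʳ Φ)    = ¬ʳ substʳ σ Φ
  substʳ σ (Φ ∨ʳ Ψ)  = substʳ σ Φ ∨ʳ substʳ σ Ψ

  satʳ-subst : ∀ {m n} (σ : Sub m n) Φ {V} → satʳ (substʳ σ Φ) V ⇔ satʳ Φ (λ i p → sat Past V i (σ p))
  satʳ-subst σ (often φ) = Often-cong (sat-subst σ φ)
  satʳ-subst σ (¬ʳ Φ)    = ¬-cong-⇔ (satʳ-subst σ Φ)
  satʳ-subst σ (Φ ∨ʳ Ψ)  = satʳ-subst σ Φ ⊎-⇔ satʳ-subst σ Ψ

  -- If switching letters recur, every position can be charged to the next switching letter,
  -- which reveals the value of the flip-flop back to the previous one; otherwise the
  -- flip-flop is eventually off.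
  module _ {n} (a b : Fin (suc n)) where

    witness : FLTL (suc n) → Bool → FLTL n
    witness φ c = hold a b Uᶠ assume a b c φ

    unflipʳ : Recurrence (suc n) → Recurrence n
    unflipʳ (often φ) = often (jump a b (witness φ)) ∨ʳ
      (¬ʳ (often (switch a b) ∨ʳ (¬ʳ often (assume a b false φ))))
    unflipʳ (¬ʳ Φ)    = ¬ʳ unflipʳ Φ
    unflipʳ (Φ ∨ʳ Ψ)  = unflipʳ Φ ∨ʳ unflipʳ Ψ

    module _ (V : Val n) where

      s : ℕ → Set
      s = Next Fut (Until Fut (λ i → V i a) (λ i → V i b))

      -- Seen in the past direction, the future-driven `s` is an ordinary flip-flop, so `assume`
      -- applies to past formulas.
      open Assume a b {Past} Succ-injective V s (Next-Until-update Succ-functional)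

      module _ (φ : FLTL (suc n)) where

        private
          W = V ▸ s

        -- The backward search crosses only holding letters, so it cannot pass the switching letter
        -- at `t`.
        witness⇒ : ∀ {t j} c → t ⊨ switch a b → t ≤ j → Is c (s j) → j ⊨ witness φ c →
                   ∃ λ i → t ≤ i × sat Past W i φ
        witness⇒ c sw t≤j sj (now x) = _ , t≤j , to (assume-correct φ c sj) x
        witness⇒ c sw t≤j sj (later h (refl , _) u) with m≤n⇒m<n∨m≡n t≤j
        ... | inj₁ t<j  = witness⇒ c sw (s≤s⁻¹ t<j) (Is-cong c (hold-keeps (refl , tt) h) sj) u
        ... | inj₂ refl = ⊥-elim (sw h)

        -- Given jumps at `t₁ < t₂` beyond `k`, the search started just before `t₂` is stopped by
        -- `t₁` and so finds a position beyond `k`.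
        jumps⇒often : Often (λ i → i ⊨ jump a b (witness φ)) → Often (λ i → sat Past W i φ)
        jumps⇒often h k with h k
        ... | t₁ , k≤t₁ , x₁ with jump-elim (witness φ) x₁ | h (suc t₁)
        ...   | _ , _ , _ , sw , _ | t₂ , t₁<t₂ , x₂ with jump-elim (witness φ) x₂
        ...     | j , c , (refl , _) , _ , sj , u with witness⇒ c sw (s≤s⁻¹ t₁<t₂) sj u
        ...       | i , t₁≤i , y = i , ≤-trans k≤t₁ t₁≤i , y

        -- The start of the search is pushed forward across holding letters until a switching letter
        -- comes next; `d` bounds the distance to a known one.
        next-jump : ∀ d {j} c → (∃ λ t → j < t × t ≤ d + j × t ⊨ switch a b) → Is c (s j) →
                    j ⊨ witness φ c → ∃ λ t → j ≤ t × t ⊨ jump a b (witness φ)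
        next-jump zero c (t , j<t , t≤j , _) _ _ = ⊥-elim (<⇒≱ j<t t≤j)
        next-jump (suc d) {j} c (t , j<t , t≤d , sw) sj u with em {suc j ⊨ hold a b}
        ... | no sw′ = suc j , n≤1+n j , jump-intro c (witness φ) (refl , tt) sw′ sj u
        ... | yes h with m≤n⇒m<n∨m≡n j<t
        ...   | inj₂ refl = ⊥-elim (sw h)
        ...   | inj₁ sj<t with next-jump d c (t , sj<t , subst (t ≤_) (sym (+-suc d j)) t≤d , sw)
                                 (Is-cong c (⇔-sym (hold-keeps (refl , tt) h)) sj) (later h (refl , tt) u)
        ...     | t′ , j<t′ , x = t′ , <⇒≤ j<t′ , x

        often⇒jumps : Often (λ i → i ⊨ switch a b) → Often (λ i → sat Past W i φ) →
                      Often (λ i → i ⊨ jump a b (witness φ))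
        often⇒jumps sws h k with h k
        ... | i , k≤i , x with sws (suc i) | is? (s i)
        ...   | t , i<t , sw | c , si with next-jump t c (t , i<t , m≤m+n t i , sw) si (now (from (assume-correct φ c si) x))
        ...     | t′ , i≤t′ , y = t′ , ≤-trans k≤i i≤t′ , y

        -- Beyond the last switching letter `b` never holds, so no until is fulfilled there.
        eventually-off : ¬ Often (λ i → i ⊨ switch a b) → ∃ λ k → ∀ i → k ≤ i → ¬ s i
        eventually-off ¬sws = ¬¬-elim λ ¬k → ¬sws λ k → ¬¬-elim λ ¬m →
          ¬k (k , λ i k≤i (j , (j≡ , _) , u) → no-switch k ¬m (≤-trans k≤i (subst (i ≤_) (sym j≡) (n≤1+n i))) u)
          where
          no-switch : ∀ k → ¬ (∃ λ m → k ≤ m × m ⊨ switch a b) → ∀ {i} → k ≤ i →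
                      ¬ Until Fut (λ i → V i a) (λ i → V i b) i
          no-switch k ¬m k≤i (now q) = ¬m (_ , k≤i , λ (_ , ¬q) → ¬q q)
          no-switch k ¬m k≤i (later _ (refl , _) u) = no-switch k ¬m (m≤n⇒m≤1+n k≤i) u

        off⇔ : ¬ Often (λ i → i ⊨ switch a b) →
               Often (λ i → i ⊨ assume a b false φ) ⇔ Often (λ i → sat Past W i φ)
        off⇔ ¬sws with eventually-off ¬sws
        ... | k₀ , off = mk⇔ (beyond λ i k₀≤i → to (assume-correct φ false (off i k₀≤i)))
                             (beyond λ i k₀≤i → from (assume-correct φ false (off i k₀≤i)))
          where
          -- Searching from `k ⊔ k₀` skips the initial segment, where `s` may still be on.
          beyond : ∀ {P Q : ℕ → Set} → (∀ i → k₀ ≤ i → P i → Q i) → Often P → Often Q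
          beyond f h k with h (k ⊔ k₀)
          ... | m , le , x = m , ≤-trans (m≤m⊔n k k₀) le , f m (≤-trans (m≤n⊔m k k₀) le) x

    unflipʳ-correct : ∀ Φ V → satʳ (unflipʳ Φ) V ⇔ satʳ Φ (V ▸ s V)
    unflipʳ-correct (often φ) V = mk⇔
      (λ { (inj₁ x) → jumps⇒often V φ x
         ; (inj₂ ¬x) → to (off⇔ V φ (¬x ∘ inj₁)) (¬¬-elim (¬x ∘ inj₂)) })
      λ x → case em of λ
        { (yes sws) → inj₁ (often⇒jumps V φ sws x)
        ; (no ¬sws) → inj₂ [ ¬sws , (λ ¬y → ¬y (from (off⇔ V φ ¬sws) x)) ] }
    unflipʳ-correct (¬ʳ Φ)   V = ¬-cong-⇔ (unflipʳ-correct Φ V)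
    unflipʳ-correct (Φ ∨ʳ Ψ) V = unflipʳ-correct Φ V ⊎-⇔ unflipʳ-correct Ψ V

  recurrence : Class
  recurrence = record
    { Form = Recurrence
    ; Frame = Lift _ ⊤
    ; R = λ _ → Past
    ; Sem = λ _ → satʳ
    ; Sem-cong = λ _ → satʳ-cong
    ; substᶜ = substʳ
    ; Sem-subst = λ _ → satʳ-subst
    ; unflip = unflipʳ
    ; Sem-unflip = λ _ → unflipʳ-correct
    }

  -- The given semantics as instances of sat

  trace : ∀ {n} → InfTrace n → Val n
  trace w i p = p ∈ w i

  Closed : (ℕ → Set) → Set
  Closed D = ∀ {i} → D (suc i) → D i

  Range : (D P Q : ℕ → Set) → ℕ → ℕ → Set
  Range D P Q i k = D k × Q k × (∀ j → i ≤ j → j < k → P j)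

  -- Down-closure of `D` puts all positions between `i` and `k` into the domain, so only `k` itself
  -- has to be checked.
  Until-future : ∀ {D P Q i} → Closed D → D i →
                 Until (Succ D) P Q i ⇔ ∃ λ k → i ≤ k × Range D P Q i k
  Until-future {D} {P} {Q} {i} closed Di = mk⇔ (fwd Di) λ (k , i≤k , x) →
      bwd (k ∸ i) i (subst (Range D P Q _) (sym (m∸n+n≡m i≤k)) x)
    where
    fwd : ∀ {i} → D i → Until (Succ D) P Q i → ∃ λ k → i ≤ k × Range D P Q i k
    fwd Di (now q) = _ , ≤-refl , Di , q , λ j i≤j j<i → ⊥-elim (<⇒≱ j<i i≤j)
    fwd {i} Di (later p (refl , Dj) u) with fwd Dj u
    ... | k , i<k , Dk , q , ps = k , <⇒≤ i<k , Dk , q , ps′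
      where
      ps′ : ∀ j → i ≤ j → j < k → P j
      ps′ j i≤j j<k with m≤n⇒m<n∨m≡n i≤j
      ... | inj₁ i<j  = ps j i<j j<k
      ... | inj₂ refl = p

    down : ∀ d {i} → D (d + i) → D i
    down zero    x = x
    down (suc d) x = down d (closed x)

    bwd : ∀ d i → Range D P Q i (d + i) → Until (Succ D) P Q i
    bwd zero    i (_ , q , _) = now q
    bwd (suc d) i x@(_ , _ , ps) with subst (Range D P Q i) (sym (+-suc d i)) x
    ... | Dk , q , ps′ = later (ps i ≤-refl (s≤s (m≤n+m i d))) (refl , down d Dk)
                           (bwd d (suc i) (Dk , q , λ j i<j → ps′ j (<⇒≤ i<j)))

  Until-past : ∀ {D P Q i} → Closed D → D i →
               Until (flip (Succ D)) P Q i ⇔ ∃ λ k → k ≤ i × Q k × (∀ j → k < j → j ≤ i → P j)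
  Until-past {D} {P} {Q} closed Di = mk⇔ fwd (bwd _ Di)
    where
    fwd : ∀ {i} → Until (flip (Succ D)) P Q i → ∃ λ k → k ≤ i × Q k × (∀ j → k < j → j ≤ i → P j)
    fwd (now q) = _ , ≤-refl , q , λ j i<j j≤i → ⊥-elim (<⇒≱ i<j j≤i)
    fwd {i} (later p (refl , _) u) with fwd u
    ... | k , k≤i , q , ps = k , m≤n⇒m≤1+n k≤i , q , ps′
      where
      ps′ : ∀ j → k < j → j ≤ i → P j
      ps′ j k<j j≤i with m≤n⇒m<n∨m≡n j≤i
      ... | inj₁ j<i  = ps j k<j (s≤s⁻¹ j<i)
      ... | inj₂ refl = p

    bwd : ∀ i → D i → (∃ λ k → k ≤ i × Q k × (∀ j → k < j → j ≤ i → P j)) → Until (flip (Succ D)) P Q i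
    bwd i Di (k , k≤i , q , ps) with m≤n⇒m<n∨m≡n k≤i
    ... | inj₂ refl = now q
    bwd (suc i) Di (k , _ , q , ps) | inj₁ k<i = later (ps (suc i) k<i ≤-refl) (refl , Di)
      (bwd i (closed Di) (k , s≤s⁻¹ k<i , q , λ j k<j j≤i → ps j k<j (m≤n⇒m≤1+n j≤i)))

  satL⇔sat : ∀ {n} (w : InfTrace n) φ i → satL w i φ ⇔ sat Fut (trace w) i φ
  satL⇔sat w (atom p) i = ⇔-refl
  satL⇔sat w (¬ᶠ φ)   i = ¬-cong-⇔ (satL⇔sat w φ i)
  satL⇔sat w (φ ∧ᶠ ψ) i = satL⇔sat w φ i ×-⇔ satL⇔sat w ψ i
  satL⇔sat w (Xᶠ φ)   i = mk⇔
    (λ x → suc i , (refl , tt) , to (satL⇔sat w φ (suc i)) x)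
    (λ { (_ , (refl , _) , x) → from (satL⇔sat w φ (suc i)) x })
  satL⇔sat w (φ Uᶠ ψ) i = ⇔-trans
    (mk⇔ (λ (k , le , q , ps) → k , le , tt , to (satL⇔sat w ψ k) q , λ j l m → to (satL⇔sat w φ j) (ps j l m))
         (λ (k , le , _ , q , ps) → k , le , from (satL⇔sat w ψ k) q , λ j l m → from (satL⇔sat w φ j) (ps j l m)))
    (⇔-sym (Until-future (λ _ → tt) tt))

  index : ∀ {m j} → j ≤ m → ∃ λ (f : Fin (suc m)) → toℕ f ≡ j
  index j≤m = fromℕ< (s≤s j≤m) , toℕ-fromℕ< (s≤s j≤m)

  satF⇔sat : ∀ {n} (w : InfTrace n) m φ i →
             satF (prefix w m) i φ ⇔ sat (Succ (_≤ m)) (trace w) (toℕ i) φ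
  satF⇔sat w m (atom p) i = ⇔-refl
  satF⇔sat w m (¬ᶠ φ)   i = ¬-cong-⇔ (satF⇔sat w m φ i)
  satF⇔sat w m (φ ∧ᶠ ψ) i = satF⇔sat w m φ i ×-⇔ satF⇔sat w m ψ i
  satF⇔sat w m (Xᶠ φ)   i = mk⇔
    (λ (j , j≡ , x) → toℕ j , (j≡ , toℕ≤pred[n] j) , to (satF⇔sat w m φ j) x)
    bwd
    where
    bwd : sat (Succ (_≤ m)) (trace w) (toℕ i) (Xᶠ φ) → satF (prefix w m) i (Xᶠ φ)
    bwd (j , (j≡ , j≤m) , x) with index j≤m
    ... | f , refl = f , j≡ , from (satF⇔sat w m φ f) x
  satF⇔sat w m (φ Uᶠ ψ) i = ⇔-trans (mk⇔ fwd bwd) (⇔-sym (Until-future {_≤ m} <⇒≤ (toℕ≤pred[n] i)))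
    where
    Window : ℕ → Set
    Window = Range (_≤ m) (λ j → sat (Succ (_≤ m)) (trace w) j φ) (λ j → sat (Succ (_≤ m)) (trace w) j ψ) (toℕ i)

    fwd : satF (prefix w m) i (φ Uᶠ ψ) → ∃ λ k → toℕ i ≤ k × Window k
    fwd (k , i≤k , q , ps) = toℕ k , i≤k , toℕ≤pred[n] k , to (satF⇔sat w m ψ k) q , ps′
      where
      ps′ : ∀ j → toℕ i ≤ j → j < toℕ k → sat (Succ (_≤ m)) (trace w) j φ
      ps′ j i≤j j<k with index (≤-trans (<⇒≤ j<k) (toℕ≤pred[n] k))
      ... | f , refl = to (satF⇔sat w m φ f) (ps f i≤j j<k)

    bwd : (∃ λ k → toℕ i ≤ k × Window k) → satF (prefix w m) i (φ Uᶠ ψ)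
    bwd (k , i≤k , k≤m , q , ps) with index k≤m
    ... | f , refl = f , i≤k , from (satF⇔sat w m ψ f) q ,
                     λ j i≤j j<k → from (satF⇔sat w m φ j) (ps (toℕ j) i≤j j<k)

  toFLTL : ∀ {n} → PLTL n → FLTL n
  toFLTL (atom p) = atom p
  toFLTL (¬ᵖ φ)   = ¬ᶠ toFLTL φ
  toFLTL (φ ∧ᵖ ψ) = toFLTL φ ∧ᶠ toFLTL ψ
  toFLTL (Yᵖ φ)   = Xᶠ (toFLTL φ)
  toFLTL (φ Sᵖ ψ) = toFLTL φ Uᶠ toFLTL ψ

  toPLTL : ∀ {n} → FLTL n → PLTL n
  toPLTL (atom p) = atom p
  toPLTL (¬ᶠ φ)   = ¬ᵖ toPLTL φ
  toPLTL (φ ∧ᶠ ψ) = toPLTL φ ∧ᵖ toPLTL ψ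
  toPLTL (Xᶠ φ)   = Yᵖ (toPLTL φ)
  toPLTL (φ Uᶠ ψ) = toPLTL φ Sᵖ toPLTL ψ

  toFLTL-toPLTL : ∀ {n} (φ : FLTL n) → toFLTL (toPLTL φ) ≡ φ
  toFLTL-toPLTL (atom p) = refl
  toFLTL-toPLTL (¬ᶠ φ)   = cong ¬ᶠ_ (toFLTL-toPLTL φ)
  toFLTL-toPLTL (φ ∧ᶠ ψ) = cong₂ _∧ᶠ_ (toFLTL-toPLTL φ) (toFLTL-toPLTL ψ)
  toFLTL-toPLTL (Xᶠ φ)   = cong Xᶠ (toFLTL-toPLTL φ)
  toFLTL-toPLTL (φ Uᶠ ψ) = cong₂ _Uᶠ_ (toFLTL-toPLTL φ) (toFLTL-toPLTL ψ)

  module _ {D : ℕ → Set} (closed : Closed D) {n} (w : InfTrace n) (m : ℕ) (D≤m : ∀ {i} → i ≤ m → D i) where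

    -- A past formula never looks beyond its own position, so any down-closed `D` containing the
    -- prefix will do: the prefix alone or the whole infinite trace.
    satP⇔sat : ∀ φ i → satP (prefix w m) i φ ⇔ sat (flip (Succ D)) (trace w) (toℕ i) (toFLTL φ)
    satP⇔sat (atom p) i = ⇔-refl
    satP⇔sat (¬ᵖ φ)   i = ¬-cong-⇔ (satP⇔sat φ i)
    satP⇔sat (φ ∧ᵖ ψ) i = satP⇔sat φ i ×-⇔ satP⇔sat ψ i
    satP⇔sat (Yᵖ φ)   i = mk⇔
      (λ (j , j≡ , x) → toℕ j , (sym j≡ , D≤m (toℕ≤pred[n] i)) , to (satP⇔sat φ j) x)
      bwd
      where
      bwd : sat (flip (Succ D)) (trace w) (toℕ i) (Xᶠ (toFLTL φ)) → satP (prefix w m) i (Yᵖ φ)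
      bwd (j , (i≡ , _) , x) with index {m} {j} (<⇒≤ (subst (_≤ m) i≡ (toℕ≤pred[n] i)))
      ... | f , refl = f , sym i≡ , from (satP⇔sat φ f) x
    satP⇔sat (φ Sᵖ ψ) i = ⇔-trans (mk⇔ fwd bwd) (⇔-sym (Until-past {D} closed (D≤m (toℕ≤pred[n] i))))
      where
      Window : Set
      Window = ∃ λ k → k ≤ toℕ i × sat (flip (Succ D)) (trace w) k (toFLTL ψ) ×
                 (∀ j → k < j → j ≤ toℕ i → sat (flip (Succ D)) (trace w) j (toFLTL φ))

      fwd : satP (prefix w m) i (φ Sᵖ ψ) → Window
      fwd (k , k≤i , q , ps) = toℕ k , k≤i , to (satP⇔sat ψ k) q , ps′
        where
        ps′ : ∀ j → toℕ k < j → j ≤ toℕ i → sat (flip (Succ D)) (trace w) j (toFLTL φ)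
        ps′ j k<j j≤i with index (≤-trans j≤i (toℕ≤pred[n] i))
        ... | f , refl = to (satP⇔sat φ f) (ps f k<j j≤i)

      bwd : Window → satP (prefix w m) i (φ Sᵖ ψ)
      bwd (k , k≤i , q , ps) with index (≤-trans k≤i (toℕ≤pred[n] i))
      ... | f , refl = f , k≤i , from (satP⇔sat ψ f) q ,
                       λ j k<j j≤i → from (satP⇔sat φ j) (ps (toℕ j) k<j j≤i)

    ⟦⟧ᵖ⇔sat : ∀ φ → ⟦ φ ⟧ᵖ (prefix w m) ⇔ sat (flip (Succ D)) (trace w) m (toFLTL φ)
    ⟦⟧ᵖ⇔sat φ = subst (λ k → ⟦ φ ⟧ᵖ (prefix w m) ⇔ sat (flip (Succ D)) (trace w) k (toFLTL φ))
      (toℕ-fromℕ m) (satP⇔sat φ (fromℕ m))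

    ⟦toPLTL⟧⇔sat : ∀ φ → ⟦ toPLTL φ ⟧ᵖ (prefix w m) ⇔ sat (flip (Succ D)) (trace w) m φ
    ⟦toPLTL⟧⇔sat φ = subst (λ χ → ⟦ toPLTL φ ⟧ᵖ (prefix w m) ⇔ sat (flip (Succ D)) (trace w) m χ)
      (toFLTL-toPLTL φ) (⟦⟧ᵖ⇔sat (toPLTL φ))

  -- Paths along traces and their end points

  infinite : Path
  infinite = record
    { R = Fut ; origin = 0
    ; functional = Succ-functional ; injective = Succ-injective
    ; no-pred = λ { (() , _) } }

  forward backward : ℕ → Path
  forward m = record
    { R = Succ (_≤ m) ; origin = 0
    ; functional = Succ-functional {_≤ m} ; injective = Succ-injective {_≤ m}
    ; no-pred = λ { (() , _) } }
  backward m = record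
    { R = flip (Succ (_≤ m)) ; origin = m
    ; functional = Succ-injective {_≤ m} ; injective = Succ-functional {_≤ m}
    -- A predecessor of `m` would be `suc m`, which the bound excludes.
    ; no-pred = λ { (refl , m<m) → <⇒≱ m<m ≤-refl } }

  eventually : ∀ {n} → FLTL n → FLTL n
  eventually φ = ⊤ᶠ Uᶠ φ

  atEnd : ∀ {n} → FLTL n → FLTL n
  atEnd φ = eventually ((¬ᶠ Xᶠ ⊤ᶠ) ∧ᶠ φ)

  irrefutable : {P : Set} → ¬ (P × ¬ P)
  irrefutable (p , ¬p) = ¬p p

  -- On a functional relation there is only one way onward, so the position without successor that
  -- `atEnd` finds must be `e`.
  sat-atEnd : ∀ {n R} (V : Val n) {i e} → Functional R → Until R (λ _ → ⊤) (_≡ e) i →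
              (∀ {j} → ¬ R e j) → ∀ φ → sat R V i (atEnd φ) ⇔ sat R V e φ
  sat-atEnd {R = R} V {e = e} R-fun path end φ = mk⇔ (fwd path) (bwd path)
    where
    fwd : ∀ {i} → Until R (λ _ → ⊤) (_≡ e) i → sat R V i (atEnd φ) → sat R V e φ
    fwd (now refl)      (now (_ , x))        = x
    fwd (now refl)      (later _ r _)        = ⊥-elim (end r)
    fwd (later _ r _)   (now (last , _))     = ⊥-elim (last (_ , r , irrefutable))
    fwd (later _ r u)   (later _ r′ v) with R-fun r r′
    ... | refl = fwd u v

    bwd : ∀ {i} → Until R (λ _ → ⊤) (_≡ e) i → sat R V e φ → sat R V i (atEnd φ)
    bwd (now refl)    x = now ((λ (_ , r , _) → end r) , x)
    bwd (later _ r u) x = later irrefutable r (bwd u x)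

  -- Past and future formulas on finite traces

  module FromOrigin = Elimination fromOrigin
  module Recurring = Elimination recurrence

  -- A fresh atom for `φ`, inspected at the last position by `atEnd`, is eliminated along the
  -- forward path; the result does not depend on `m`.
  past→future : ∀ {n} (φ : PLTL n) → ∃ λ (φ′ : FLTL n) → ∀ w m → ⟦ φ ⟧ᵖ (prefix w m) ⇔ ⟦ φ′ ⟧ᶠ (prefix w m)
  past→future φ with FromOrigin.eliminate (toFLTL φ) id (atEnd (atom zero))
  ... | φ′ , e = φ′ , λ w m → ⇔-trans (⟦⟧ᵖ⇔sat <⇒≤ w m id φ) (⇔-sym
    (⇔-trans (satF⇔sat w m φ′ zero) (⇔-trans (e (forward m) (trace w))
    (sat-atEnd (trace w ▸ λ i → sat (flip (Succ (_≤ m))) (trace w) i (toFLTL φ))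
      Succ-functional (path m) (λ { (refl , m<m) → <⇒≱ m<m ≤-refl }) (atom zero)))))
    where
    path : ∀ m → Until (Succ (_≤ m)) (λ _ → ⊤) (_≡ m) 0
    path m = from (Until-future {_≤ m} <⇒≤ z≤n) (m , z≤n , ≤-refl , refl , λ _ _ _ → tt)

  -- The mirror image: the path starts at `m` and runs backwards, so its end is position `0`, where
  -- `φ` is evaluated.
  future→past : ∀ {n} (φ : FLTL n) → ∃ λ (φ′ : PLTL n) → ∀ w m → ⟦ φ ⟧ᶠ (prefix w m) ⇔ ⟦ φ′ ⟧ᵖ (prefix w m)
  future→past φ with FromOrigin.eliminate φ id (atEnd (atom zero))
  ... | φ′ , e = toPLTL φ′ , λ w m → ⇔-trans (satF⇔sat w m φ zero) (⇔-sym
    (⇔-trans (⟦toPLTL⟧⇔sat <⇒≤ w m id φ′) (⇔-trans (e (backward m) (trace w))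
    (sat-atEnd (trace w ▸ λ i → sat (Succ (_≤ m)) (trace w) i φ)
      (Succ-injective {_≤ m}) (path m) (λ { (() , _) }) (atom zero)))))
    where
    path : ∀ m → Until (flip (Succ (_≤ m))) (λ _ → ⊤) (_≡ 0) m
    path m = from (Until-past {_≤ m} <⇒≤ ≤-refl) (0 , z≤n , refl , λ _ _ _ → tt)

  -- Translation under the quantifiers over prefixes

  map⁺ : ∀ {F G : Set} → (F → G) → Plus F → Plus G
  map⁺ f (∀ᴾ φ)   = ∀ᴾ (f φ)
  map⁺ f (∃ᴾ φ)   = ∃ᴾ (f φ)
  map⁺ f (∃∞ᴾ φ)  = ∃∞ᴾ (f φ)
  map⁺ f (∀∞ᴾ φ)  = ∀∞ᴾ (f φ)
  map⁺ f (Φ ∨ᴾ Ψ) = map⁺ f Φ ∨ᴾ map⁺ f Ψ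
  map⁺ f (Φ ∧ᴾ Ψ) = map⁺ f Φ ∧ᴾ map⁺ f Ψ
  map⁺ f (¬ᴾ Φ)   = ¬ᴾ map⁺ f Φ

  module _ {n} {F G : Set} (semF : F → FinProp n) (semG : G → FinProp n) (f : F → G)
    (f-correct : ∀ φ w m → semF φ (prefix w m) ⇔ semG (f φ) (prefix w m)) where

    map⁺-correct : ∀ Ψ → ⟦ semF ⟧⁺ Ψ ≐ ⟦ semG ⟧⁺ (map⁺ f Ψ)
    map⁺-correct (∀ᴾ φ) w   = mk⇔ (λ h m → to (f-correct φ w m) (h m)) (λ h m → from (f-correct φ w m) (h m))
    map⁺-correct (∃ᴾ φ) w   = mk⇔ (map₂ (to (f-correct φ w _))) (map₂ (from (f-correct φ w _)))
    map⁺-correct (∃∞ᴾ φ) w  = Often-cong (f-correct φ w)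
    map⁺-correct (∀∞ᴾ φ) w  = mk⇔ (map₂ λ h m k≤m → to (f-correct φ w m) (h m k≤m))
                                  (map₂ λ h m k≤m → from (f-correct φ w m) (h m k≤m))
    map⁺-correct (Φ ∨ᴾ Ψ) w = map⁺-correct Φ w ⊎-⇔ map⁺-correct Ψ w
    map⁺-correct (Φ ∧ᴾ Ψ) w = map⁺-correct Φ w ×-⇔ map⁺-correct Ψ w
    map⁺-correct (¬ᴾ Ψ) w   = ¬-cong-⇔ (map⁺-correct Ψ w)

  -- From quantified past formulas to LTL

  sat-eventually : ∀ {n} (V : Val n) i φ → sat Fut V i (eventually φ) ⇔ ∃ λ k → i ≤ k × sat Fut V k φ
  sat-eventually V i φ = ⇔-trans (Until-future (λ _ → tt) tt)
    (mk⇔ (map₂ λ (i≤k , _ , x , _) → i≤k , x) (map₂ λ (i≤k , x) → i≤k , tt , x , λ _ _ _ → irrefutable))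

  always : ∀ {n} → FLTL n → FLTL n
  always φ = ¬ᶠ eventually (¬ᶠ φ)

  sat-always : ∀ {n} (V : Val n) i φ → sat Fut V i (always φ) ⇔ (∀ k → i ≤ k → sat Fut V k φ)
  sat-always V i φ = ⇔-trans (¬-cong-⇔ (sat-eventually V i (¬ᶠ φ)))
    (mk⇔ (λ h k i≤k → ¬¬-elim λ ¬x → h (k , i≤k , ¬x)) (λ h (k , i≤k , ¬x) → ¬x (h k i≤k)))

  Past⁺⊆LTL : ∀ {n} (Ψ : PPLTL⁺ n) → ∃ λ (φ : FLTL n) → ⟦ Ψ ⟧PPLTL⁺ ≐ ⟦ φ ⟧ˡ
  Past⁺⊆LTL {n} = go
    where
    W : PLTL n → InfTrace n → Val (suc n)
    W φ w = trace w ▸ λ m → ⟦ φ ⟧ᵖ (prefix w m)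

    -- The fresh atom marks the positions whose prefix satisfies `φ`. Since `φ` reads the same on
    -- the infinite trace, the atom can be eliminated from `χ` along the infinite path.
    quantified : (φ : PLTL n) (χ : FLTL (suc n)) → ∃ λ (φ′ : FLTL n) → ∀ w →
                 sat Fut (W φ w) 0 χ ⇔ ⟦ φ′ ⟧ˡ w
    quantified φ χ with FromOrigin.eliminate (toFLTL φ) id χ
    ... | φ′ , e = φ′ , λ w → ⇔-trans
      (sat-cong (▸-cong (λ _ _ → ⇔-refl) λ m → ⟦⟧ᵖ⇔sat (λ _ → tt) w m (λ _ → tt) φ) χ 0)
      (⇔-trans (⇔-sym (e infinite (trace w))) (⇔-sym (satL⇔sat w φ′ 0)))

    p : FLTL (suc n)
    p = atom zero

    go : ∀ Ψ → ∃ λ (φ : FLTL n) → ⟦ Ψ ⟧PPLTL⁺ ≐ ⟦ φ ⟧ˡ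
    go (∀ᴾ φ) with quantified φ (always p)
    ... | φ′ , e = φ′ , λ w → ⇔-trans
      (mk⇔ (λ h → from (sat-always (W φ w) 0 p) λ k _ → h k)
           (λ h k → to (sat-always (W φ w) 0 p) h k z≤n)) (e w)
    go (∃ᴾ φ) with quantified φ (eventually p)
    ... | φ′ , e = φ′ , λ w → ⇔-trans
      (mk⇔ (λ (k , x) → from (sat-eventually (W φ w) 0 p) (k , z≤n , x))
           (λ h → map₂ proj₂ (to (sat-eventually (W φ w) 0 p) h))) (e w)
    go (∃∞ᴾ φ) with quantified φ (always (eventually p))
    ... | φ′ , e = φ′ , λ w → ⇔-trans
      (mk⇔ (λ h → from (sat-always (W φ w) 0 (eventually p)) λ k _ → from (sat-eventually (W φ w) k p) (h k))
           (λ h k → to (sat-eventually (W φ w) k p) (to (sat-always (W φ w) 0 (eventually p)) h k z≤n))) (e w)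
    go (∀∞ᴾ φ) with quantified φ (eventually (always p))
    ... | φ′ , e = φ′ , λ w → ⇔-trans
      (mk⇔ (λ (k , h) → from (sat-eventually (W φ w) 0 (always p)) (k , z≤n , from (sat-always (W φ w) k p) h))
           (λ h → map₂ (λ (_ , x) → to (sat-always (W φ w) _ p) x) (to (sat-eventually (W φ w) 0 (always p)) h))) (e w)
    go (Φ ∨ᴾ Ψ) with go Φ | go Ψ
    ... | φ , e | ψ , f = φ ∨ᶠ ψ , λ w → ⇔-trans (e w ⊎-⇔ f w) (⇔-sym de-Morgan)
    go (Φ ∧ᴾ Ψ) with go Φ | go Ψ
    ... | φ , e | ψ , f = φ ∧ᶠ ψ , λ w → e w ×-⇔ f w
    go (¬ᴾ Ψ) with go Ψ
    ... | φ , e = ¬ᶠ φ , λ w → ¬-cong-⇔ (e w)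

  -- From LTL to quantified past formulas

  recurrence⁺ : ∀ {n} → Recurrence n → PPLTL⁺ n
  recurrence⁺ (often φ) = ∃∞ᴾ (toPLTL φ)
  recurrence⁺ (¬ʳ Φ)    = ¬ᴾ recurrence⁺ Φ
  recurrence⁺ (Φ ∨ʳ Ψ)  = recurrence⁺ Φ ∨ᴾ recurrence⁺ Ψ

  recurrence⁺-correct : ∀ {n} (Φ : Recurrence n) w → ⟦ recurrence⁺ Φ ⟧PPLTL⁺ w ⇔ satʳ Φ (trace w)
  recurrence⁺-correct (often φ) w = Often-cong λ m → ⟦toPLTL⟧⇔sat (λ _ → tt) w m (λ _ → tt) φ
  recurrence⁺-correct (¬ʳ Φ)    w = ¬-cong-⇔ (recurrence⁺-correct Φ w)
  recurrence⁺-correct (Φ ∨ʳ Ψ)  w = recurrence⁺-correct Φ w ⊎-⇔ recurrence⁺-correct Ψ w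

  -- Read backwards, `atEnd` leads to position `0` from everywhere, so its truth is the same at all
  -- positions and `often` adds nothing. Eliminating the atom for `φ` then leaves a Boolean
  -- combination of recurrences of past formulas.
  LTL⊆Past⁺ : ∀ {n} (φ : FLTL n) → ∃ λ (Ψ : PPLTL⁺ n) → ⟦ φ ⟧ˡ ≐ ⟦ Ψ ⟧PPLTL⁺
  LTL⊆Past⁺ φ with Recurring.eliminate φ id (often (atEnd (atom zero)))
  ... | Φ , e = recurrence⁺ Φ , λ w → ⇔-trans (satL⇔sat w φ 0) (⇔-sym
    (⇔-trans (recurrence⁺-correct Φ w) (⇔-trans (e (lift tt) (trace w))
    (⇔-trans (Often-cong λ i → sat-atEnd (trace w ▸ λ j → sat Fut (trace w) j φ)
      Succ-injective (path i) (λ { (() , _) }) (atom zero))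
    (mk⇔ (λ h → proj₂ (proj₂ (h 0))) (λ x k → k , ≤-refl , x))))))
    where
    path : ∀ i → Until Past (λ _ → ⊤) (_≡ 0) i
    path i = from (Until-past (λ _ → tt) tt) (0 , z≤n , refl , λ _ _ _ → tt)

theorem3 : ExcludedMiddle 0ℓ → (n : ℕ) → (Z : InfProp n) →
    ((∃ λ (Ψ : LTLf⁺ n) → Z ≐ ⟦ Ψ ⟧LTLf⁺) ⇔ (∃ λ (Ψ' : PPLTL⁺ n) → Z ≐ ⟦ Ψ' ⟧PPLTL⁺))
    × ((∃ λ (Ψ' : PPLTL⁺ n) → Z ≐ ⟦ Ψ' ⟧PPLTL⁺) ⇔ (∃ λ (φ : FLTL n) → Z ≐ ⟦ φ ⟧ˡ))
theorem3 em n Z =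
    mk⇔ (λ (Ψ , e) → map⁺ (proj₁ ∘ future→past) Ψ , λ w →
          ⇔-trans (e w) (map⁺-correct ⟦_⟧ᶠ ⟦_⟧ᵖ _ (proj₂ ∘ future→past) Ψ w))
        (λ (Ψ , e) → map⁺ (proj₁ ∘ past→future) Ψ , λ w →
          ⇔-trans (e w) (map⁺-correct ⟦_⟧ᵖ ⟦_⟧ᶠ _ (proj₂ ∘ past→future) Ψ w))
  , mk⇔ (λ (Ψ , e) → proj₁ (Past⁺⊆LTL Ψ) , λ w → ⇔-trans (e w) (proj₂ (Past⁺⊆LTL Ψ) w))
        (λ (φ , e) → proj₁ (LTL⊆Past⁺ φ) , λ w → ⇔-trans (e w) (proj₂ (LTL⊆Past⁺ φ) w))
  where open Classical em
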